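{- There exists a laminar matroid prophet inequality instance such that every non-adaptive algorithm has competitive ratio at least $2.217$ on it, i.e., every non-adaptive algorithm $\mathrm{ALG}$ satisfies $\mathbb{E}[\mathrm{OPT}]\ge 2.217\cdot\mathbb{E}[\mathrm{ALG}]$ on that instance.
   Context: Matroid prophet inequality instance: a matroid $M=([n],\mathcal I)$ together with independent nonnegative random variables $X_1,\dots,X_n$ with known distributions ($X_i$ is the value of item $i$). Items arrive in the known order $1,2,\dots,n$; when item $i$ arrives its realized value is observed and the algorithm must immediately and irrevocably accept or reject it, keeping the accepted set independent in $M$. $\mathbb{E}[\mathrm{ALG}]$ is the expected total value of accepted items and $\mathbb{E}[\mathrm{OPT}]=\mathbb{E}[\max_{I\in\mathcal I}\sum_{i\in I}X_i]$. Non-adaptive algorithm: thresholds $T_1,\dots,T_n\in[0,+\infty]$ (possibly different for different items, possibly chosen at random) are fixed before any value is realized, depending only on the distributions, the matroid and the arrival order; when item $i$ arrives it is accepted if and only if $X_i\ge T_i$ and adding $i$ keeps the accepted set independent. (Random choices, including random tie-breaking at the threshold, are made ex ante, independently of the values.) Laminar matroid: a family $\mathcal L\subseteq 2^N$ is laminar if for all $A,B\in\mathcal L$, either $A\cap B=\varnothing$, $A\subseteq B$, or $B\subseteq A$. A laminar matroid is specified by a laminar family $\mathcal L$ and integer ranks $(r_S)_{S\in\mathcal L}$ (with $r_A\le r_B$ whenever $A\subseteq B$); a set $I\subseteq N$ is independent iff $|I\cap S|\le r_S$ for every $S\in\mathcal L$. -}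

module Defs where

open import Algebra.Structures using (IsCommutativeRing)
open import Algebra.Bundles using (CommutativeRing)
open import Data.Bool.Base using (Bool; false; not; if_then_else_; _∧_)
open import Data.Fin.Base using (Fin; zero; suc)
open import Data.Fin.Properties using (all?)
open import Data.Fin.Subset
  using (Subset; inside; outside; ⊥; ⁅_⁆; _∩_; _∪_; _⊆_; Empty; ∣_∣)
open import Data.List.Base using (List; []; _∷_; _++_; map; filter; foldl; allFin)
open import Data.Nat.Base using (ℕ; zero; suc) renaming (_≤_ to _≤ⁿ_)
open import Data.Nat.Properties using () renaming (_≤?_ to _≤ⁿ?_)
open import Data.Product.Base using (∃; _,_)
open import Data.Sum.Base using (_⊎_)
import Data.Rational.Base as ℚ
import Data.Rational.Properties as ℚₚ
open import Data.Vec.Base as Vec using (lookup)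
import Data.Vec.Functional as F
open import Level using (Level; _⊔_) renaming (zero to 0ℓ; suc to lsuc)
open import Relation.Binary.Bundles using (DecTotalOrder)
open import Relation.Binary.Core using (Rel)
open import Relation.Binary.Structures using (IsDecTotalOrder)
open import Relation.Binary.PropositionalEquality using (_≡_; sym; subst)
open import Relation.Nullary using (¬_; Dec; does)

-- The real numbers enter only through their ordered-field structure: everything
-- below is stated for an arbitrary totally ordered field.  Classically ℝ is one;
-- ℚ is one outright (see ℚ-orderedField).
record OrderedField c ℓ₁ ℓ₂ : Set (lsuc (c ⊔ ℓ₁ ⊔ ℓ₂)) where
  infix  8 -_
  infixl 7 _*_
  infixl 6 _+_
  infix  4 _≈_ _≤_ _<_
  field
    Carrier           : Set c
    _≈_               : Rel Carrier ℓ₁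
    _≤_               : Rel Carrier ℓ₂
    _+_ _*_           : Carrier → Carrier → Carrier
    -_                : Carrier → Carrier
    0# 1#             : Carrier
    isCommutativeRing : IsCommutativeRing _≈_ _+_ _*_ -_ 0# 1#
    isDecTotalOrder   : IsDecTotalOrder _≈_ _≤_
    0≉1               : ¬ (0# ≈ 1#)
    inverse           : ∀ x → ¬ (x ≈ 0#) → ∃ λ y → x * y ≈ 1#
    +-monoˡ-≤         : ∀ z {x y} → x ≤ y → x + z ≤ y + z
    *-nonneg          : ∀ {x y} → 0# ≤ x → 0# ≤ y → 0# ≤ x * y

  _<_ : Rel Carrier ℓ₂
  x < y = ¬ (y ≤ x)

  commutativeRing : CommutativeRing c ℓ₁
  commutativeRing = record { isCommutativeRing = isCommutativeRing }

  decTotalOrder : DecTotalOrder c ℓ₁ ℓ₂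
  decTotalOrder = record { isDecTotalOrder = isDecTotalOrder }

ℚ-orderedField : OrderedField 0ℓ 0ℓ 0ℓ
ℚ-orderedField = record
  { Carrier           = ℚ.ℚ
  ; _≈_               = _≡_
  ; _≤_               = ℚ._≤_
  ; _+_               = ℚ._+_
  ; _*_               = ℚ._*_
  ; -_                = ℚ.-_
  ; 0#                = ℚ.0ℚ
  ; 1#                = ℚ.1ℚ
  ; isCommutativeRing = ℚₚ.+-*-isCommutativeRing
  ; isDecTotalOrder   = ℚₚ.≤-isDecTotalOrder
  ; 0≉1               = λ ()
  ; inverse           = λ x x≢0 → let instance _ = ℚ.≢-nonZero x≢0 in
                          (ℚ.1/ x) , ℚₚ.*-inverseʳ x
  ; +-monoˡ-≤         = ℚₚ.+-monoˡ-≤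
  ; *-nonneg          = λ {x} {y} 0≤x 0≤y →
                          subst (ℚ._≤ x ℚ.* y) (ℚₚ.*-zeroˡ y)
                            (ℚₚ.*-monoʳ-≤-nonNeg y {{ℚ.nonNegative 0≤y}} 0≤x)
  }

record LaminarMatroid (n : ℕ) : Set where
  field
    size      : ℕ
    set       : Fin size → Subset n
    rank      : Fin size → ℕ
    laminar   : ∀ i j → Empty (set i ∩ set j) ⊎ set i ⊆ set j ⊎ set j ⊆ set i
    rank-mono : ∀ i j → set i ⊆ set j → rank i ≤ⁿ rank j

  Independent : Subset n → Set
  Independent I = ∀ j → ∣ I ∩ set j ∣ ≤ⁿ rank j

  independent? : ∀ I → Dec (Independent I)
  independent? I = all? λ j → ∣ I ∩ set j ∣ ≤ⁿ? rank j

subsets : ∀ n → List (Subset n)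
subsets zero    = Vec.[] ∷ []
subsets (suc n) = map (outside Vec.∷_) (subsets n) ++ map (inside Vec.∷_) (subsets n)

module Prophet {c ℓ₁ ℓ₂} (𝔽 : OrderedField c ℓ₁ ℓ₂) where

  open OrderedField 𝔽 public
  open DecTotalOrder decTotalOrder public using (_≤?_; totalOrder)
  open CommutativeRing commutativeRing public using (+-rawMonoid)
  open import Algebra.Definitions.RawMonoid +-rawMonoid public using (sum; _×_)
  open import Data.List.Extrema totalOrder public using (max)

  -- The law of a nonnegative random variable with finitely many values.
  record Distribution : Set (c ⊔ ℓ₁ ⊔ ℓ₂) where
    field
      size     : ℕ
      prob     : Fin size → Carrier
      value    : Fin size → Carrier
      prob≥0   : ∀ j → 0# ≤ prob j
      value≥0  : ∀ j → 0# ≤ value j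
      sum-prob : sum prob ≈ 1#

  -- Expectation of f (X₁ , … , Xₙ) for independent Xᵢ with laws Dᵢ, i.e. with
  -- respect to the product law.
  𝔼 : ∀ {n} → (Fin n → Distribution) → ((Fin n → Carrier) → Carrier) → Carrier
  𝔼 {zero}  D f = f F.[]
  𝔼 {suc n} D f = sum λ j → prob j * 𝔼 (F.tail D) (λ x → f (value j F.∷ x))
    where open Distribution (F.head D)

  -- Items arrive in the order of Fin n.
  record Instance : Set (c ⊔ ℓ₁ ⊔ ℓ₂) where
    field
      n       : ℕ
      matroid : LaminarMatroid n
      law     : Fin n → Distribution

  weight : ∀ {n} → Subset n → (Fin n → Carrier) → Carrier
  weight S x = sum λ i → if lookup S i then x i else 0#

  -- The seed 0# of the maximum is the weight of ∅, which is always independent.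
  opt : ∀ {n} → LaminarMatroid n → (Fin n → Carrier) → Carrier
  opt {n} M x = max 0# (map (λ I → weight I x) (filter independent? (subsets n)))
    where open LaminarMatroid M

  𝔼OPT : Instance → Carrier
  𝔼OPT I = 𝔼 law (opt matroid)
    where open Instance I

  -- A threshold in [0,+∞].  A value equal to a finite threshold t is accepted
  -- under `at-least t` and rejected under `above t`: a (possibly random) ex ante
  -- choice between the two is a tie-breaking rule.
  data Threshold : Set (c ⊔ ℓ₂) where
    at-least : ∀ t → 0# ≤ t → Threshold
    above    : ∀ t → 0# ≤ t → Threshold
    +∞       : Threshold

  meets : Threshold → Carrier → Bool
  meets (at-least t _) x = does (t ≤? x)
  meets (above t _)    x = not (does (x ≤? t))
  meets +∞             x = false

  accepted : ∀ {n} → LaminarMatroid n → (Fin n → Threshold) → (Fin n → Carrier) → Subset n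
  accepted {n} M T x = foldl step ⊥ (allFin n)
    where
    open LaminarMatroid M
    step : Subset n → Fin n → Subset n
    step S i = if meets (T i) (x i) ∧ does (independent? (S ∪ ⁅ i ⁆))
               then S ∪ ⁅ i ⁆ else S

  𝔼reward : (I : Instance) → (Fin (Instance.n I) → Threshold) → Carrier
  𝔼reward I T = 𝔼 law λ x → weight (accepted matroid T x) x
    where open Instance I

  -- The algorithm's randomness is seen only through expectation: a normalised
  -- positive linear functional on a space of integrable functions.  Integration
  -- against any probability measure on Ω is an example; σ-additivity is not
  -- demanded, which only admits more algorithms.
  record RandomSource a b : Set (c ⊔ ℓ₁ ⊔ ℓ₂ ⊔ lsuc (a ⊔ b)) where
    field
      Ω            : Set a
      Integrable   : (Ω → Carrier) → Set b
      ∫            : ∀ f → Integrable f → Carrier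
      const-int    : ∀ k → Integrable (λ _ → k)
      +-int        : ∀ {f g} → Integrable f → Integrable g → Integrable (λ ω → f ω + g ω)
      *-int        : ∀ k {f} → Integrable f → Integrable (λ ω → k * f ω)
      ∫-const      : ∀ k (p : Integrable (λ _ → k)) → ∫ (λ _ → k) p ≈ k
      ∫-+          : ∀ {f g} (p : Integrable f) (q : Integrable g)
                     (r : Integrable (λ ω → f ω + g ω)) →
                     ∫ (λ ω → f ω + g ω) r ≈ ∫ f p + ∫ g q
      ∫-*          : ∀ k {f} (p : Integrable f) (q : Integrable (λ ω → k * f ω)) →
                     ∫ (λ ω → k * f ω) q ≈ k * ∫ f p
      ∫-mono       : ∀ {f g} (p : Integrable f) (q : Integrable g) →
                     (∀ ω → f ω ≤ g ω) → ∫ f p ≤ ∫ g q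

  -- Thresholds may depend on everything in the instance and on ω, which is
  -- independent of the values.  `integrable` says that 𝔼[ALG] is defined.
  record NonAdaptive a b (I : Instance) : Set (c ⊔ ℓ₁ ⊔ ℓ₂ ⊔ lsuc (a ⊔ b)) where
    field
      source : RandomSource a b
    open RandomSource source public
    field
      threshold  : Ω → Fin (Instance.n I) → Threshold
      integrable : Integrable (λ ω → 𝔼reward I (threshold ω))

  𝔼ALG : ∀ {a b} (I : Instance) → NonAdaptive a b I → Carrier
  𝔼ALG I A = ∫ (λ ω → 𝔼reward I (threshold ω)) integrable
    where open NonAdaptive A

{-# OPTIONS --safe #-}
-- The instance is a chain matroid of ranks 3 ⊃ 2 ⊃ 1, the outer items arriving
-- first: 64 small gambles (value 4 with probability 1/16), 64 larger ones (10
-- with probability 1/16), a sure item of value 29, and finally a long shot of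
-- mean 29 (29000 with probability 1/1000).  A prophet almost always collects
-- one item of each of the first two kinds, and both 29s up to a loss of 1/1000.
-- A non-adaptive algorithm that fills slots early is likely to lose both 29s,
-- and one that does not earns little beyond a single 29.
--
-- Since the outer items come first, the past matters only through the number of
-- free slots, and since items of a kind are identical, thresholds matter only
-- through how many of them are open.  That leaves 65 · 65 · 4 profiles, whose
-- rewards are compared with the value of a backward greedy choice by exact
-- arithmetic on common denominators.
module Submission where

open import Defs
open import Level using (Level)
open import Data.Product using (Σ) renaming (_×_ to _and_)
open import Algebra.Bundles using (CommutativeRing)
open import Data.Bool.Base using (Bool; true; false; T; not; if_then_else_; _∧_)
open import Data.Bool.Properties using (T-∧; T-≡)
open import Data.Fin.Base using (Fin; zero; suc)
open import Data.Fin.Subset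
  using (Subset; inside; outside; ⊤; ⊥; ⁅_⁆; _∪_; _⊆_; ∣_∣)
open import Data.Fin.Subset.Properties
  using (∈⊤; ⊆⊤; s⊆s; drop-∷-⊆; ∣p∩q∣≤∣p∣; ∣⊥∣≡0; ∩-identityʳ; ∪-identityˡ)
open import Data.List.Base as List
  using (List; []; _∷_; _++_; length; foldl; allFin; replicate; applyUpTo)
open import Data.List.Membership.Propositional using (_∈_; lose)
open import Data.List.Membership.Propositional.Properties
  using (∈-map⁺; ∈-++⁺ˡ; ∈-++⁺ʳ; ∈-filter⁺)
open import Data.List.Properties using (map-tabulate)
open import Data.List.Relation.Unary.Any using (here)
open import Data.Nat.Base as ℕ using (ℕ; zero; suc; pred; NonZero; _⊓_; _<ᵇ_)
import Data.Nat.Properties as ℕₚ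
import Algebra.Properties.CommutativeSemigroup ℕₚ.*-commutativeSemigroup as ℕ*
open import Data.Product.Base using (∃; _,_)
open import Data.Sum.Base using (_⊎_; inj₁; inj₂)
open import Data.Vec.Base using (_∷_; [])
import Data.Vec.Functional as F
open import Function.Base using (_∘_; id)
open import Function.Bundles using (_⇔_; mk⇔; module Equivalence)
open import Relation.Binary.Bundles using (DecTotalOrder)
open import Relation.Binary.PropositionalEquality as ≡ using (_≡_)
open import Relation.Nullary using (¬_; does)
open import Relation.Nullary.Decidable using (does-⇔; dec-true; dec-false)

-- Chain matroids, and what remains of them after the first item.

module ChainMatroid where
  open import Data.Nat.Base
  open import Data.Nat.Properties
  open ≡ using (refl; sym; trans; cong; subst; subst₂)

  ∈-subsets : ∀ {n} (I : Subset n) → I ∈ subsets n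
  ∈-subsets []            = here refl
  ∈-subsets (outside ∷ I) = ∈-++⁺ˡ (∈-map⁺ (outside ∷_) (∈-subsets I))
  ∈-subsets (inside ∷ I)  = ∈-++⁺ʳ _ (∈-map⁺ (inside ∷_) (∈-subsets I))

  -- A Bernoulli item: it has value worth with probability 1 / suc odds and
  -- the value 0 otherwise; at most cap items may be chosen from it onwards.
  record Item : Set where
    constructor item
    field
      odds worth cap : ℕ
      {{worth≢0}}    : NonZero worth
  open Item public

  suffix : ∀ {n} → Fin n → Subset n
  suffix zero    = ⊤
  suffix (suc i) = outside ∷ suffix i

  suffix-chain : ∀ {n} (i j : Fin n) → suffix i ⊆ suffix j ⊎ suffix j ⊆ suffix i
  suffix-chain zero    j       = inj₂ ⊆⊤
  suffix-chain (suc i) zero    = inj₁ ⊆⊤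
  suffix-chain (suc i) (suc j) with suffix-chain i j
  ... | inj₁ i⊆j = inj₁ (s⊆s i⊆j)
  ... | inj₂ j⊆i = inj₂ (s⊆s j⊆i)

  -- Running minima, so that ranks decrease along the chain whatever the caps are.
  suffixRank : ℕ → (xs : List Item) → Fin (length xs) → ℕ
  suffixRank s (x ∷ xs) zero    = cap x ⊓ s
  suffixRank s (x ∷ xs) (suc i) = suffixRank (cap x ⊓ s) xs i

  suffixRank-≤ : ∀ s xs i → suffixRank s xs i ≤ s
  suffixRank-≤ s (x ∷ xs) zero    = m⊓n≤n (cap x) s
  suffixRank-≤ s (x ∷ xs) (suc i) = ≤-trans (suffixRank-≤ _ xs i) (m⊓n≤n (cap x) s)

  suffixRank-mono : ∀ s xs i j → suffix i ⊆ suffix j → suffixRank s xs i ≤ suffixRank s xs j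
  suffixRank-mono s (x ∷ xs) zero    zero    _   = ≤-refl
  suffixRank-mono s (x ∷ xs) (suc i) zero    _   = suffixRank-≤ _ xs i
  suffixRank-mono s (x ∷ xs) zero    (suc j) i⊆j with () ← i⊆j {zero} ∈⊤
  suffixRank-mono s (x ∷ xs) (suc i) (suc j) i⊆j = suffixRank-mono _ xs i j (drop-∷-⊆ i⊆j)

  -- A running minimum may absorb a bound at its start or at its end; so losing a slot amounts to
  -- cutting every later rank at `t`.
  suffixRank-⊓ : ∀ s t xs i → suffixRank (s ⊓ t) xs i ≡ suffixRank s xs i ⊓ t
  suffixRank-⊓ s t (x ∷ xs) zero    = sym (⊓-assoc (cap x) s t)
  suffixRank-⊓ s t (x ∷ xs) (suc i) =
    trans (cong (λ r → suffixRank r xs i) (sym (⊓-assoc (cap x) s t))) (suffixRank-⊓ (cap x ⊓ s) t xs i)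

  -- s is the number of slots left over by the earlier items.
  chain : ℕ → (xs : List Item) → LaminarMatroid (length xs)
  chain s xs = record
    { size      = length xs
    ; set       = suffix
    ; rank      = suffixRank s xs
    ; laminar   = λ i j → inj₂ (suffix-chain i j)
    ; rank-mono = suffixRank-mono s xs
    }

  Fits : ∀ s xs → Subset (length xs) → Set
  Fits s xs = LaminarMatroid.Independent (chain s xs)

  fits⇒∣∣≤ : ∀ s xs I → Fits s xs I → ∣ I ∣ ≤ s
  fits⇒∣∣≤ s []       []  _    = z≤n
  fits⇒∣∣≤ s (x ∷ xs) I fits = ≤-trans
    (subst (λ J → ∣ J ∣ ≤ cap x ⊓ s) (∩-identityʳ I) (fits zero)) (m⊓n≤n (cap x) s)

  -- The constraint on the whole set is implied by the later ones: their starting value `cap x ⊓ s`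
  -- already bounds the size of `I`, by `fits⇒∣∣≤`.
  fits-outside : ∀ s x xs I → Fits s (x ∷ xs) (outside ∷ I) ⇔ Fits (cap x ⊓ s) xs I
  fits-outside s x xs I = mk⇔ (λ fits i → fits (suc i)) from
    where
    from : Fits (cap x ⊓ s) xs I → Fits s (x ∷ xs) (outside ∷ I)
    from fits zero    = subst (λ J → ∣ J ∣ ≤ cap x ⊓ s) (sym (∩-identityʳ I)) (fits⇒∣∣≤ _ xs I fits)
    from fits (suc i) = fits i

  fits-⊓ : ∀ {s} t xs I → Fits s xs I → ∣ I ∣ ≤ t → Fits (s ⊓ t) xs I
  fits-⊓ {s} t xs I fits ∣I∣≤t i = subst (_ ≤_) (sym (suffixRank-⊓ s t xs i))
    (⊓-glb (fits i) (≤-trans (∣p∩q∣≤∣p∣ I (suffix i)) ∣I∣≤t))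

  fits-inside⁺ : ∀ s x xs I → ∣ I ∣ < cap x ⊓ s → Fits (cap x ⊓ s) xs I → Fits s (x ∷ xs) (inside ∷ I)
  fits-inside⁺ s x xs I ∣I∣<s fits zero    =
    subst (λ J → suc ∣ J ∣ ≤ cap x ⊓ s) (sym (∩-identityʳ I)) ∣I∣<s
  fits-inside⁺ s x xs I ∣I∣<s fits (suc i) = fits i

  -- The constraint on the whole set leaves room for `t` further items. That size bound can be moved
  -- into every later rank by `fits-⊓`, and conversely `Fits t xs I` forces `∣ I ∣ ≤ t`.
  fits-inside : ∀ s {t} x xs I → cap x ⊓ s ≡ suc t → Fits s (x ∷ xs) (inside ∷ I) ⇔ Fits t xs I
  fits-inside s {t} x xs I eq = mk⇔ to from
    where
    suct⊓t : cap x ⊓ s ⊓ t ≡ t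
    suct⊓t = trans (cong (_⊓ t) eq) (m≥n⇒m⊓n≡n (n≤1+n t))

    to : Fits s (x ∷ xs) (inside ∷ I) → Fits t xs I
    to fits = subst (λ r → Fits r xs I) suct⊓t (fits-⊓ t xs I (λ i → fits (suc i))
      (s≤s⁻¹ (subst₂ _≤_ (cong (suc ∘ ∣_∣) (∩-identityʳ I)) eq (fits zero))))

    from : Fits t xs I → Fits s (x ∷ xs) (inside ∷ I)
    from fits = fits-inside⁺ s x xs I
      (subst (∣ I ∣ <_) (sym eq) (s≤s (fits⇒∣∣≤ t xs I fits)))
      λ i → ≤-trans (fits i) (≤-trans (≤-reflexive (rank-≡ i)) (m⊓n≤m _ t))
      where
      rank-≡ : ∀ i → suffixRank t xs i ≡ suffixRank (cap x ⊓ s) xs i ⊓ t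
      rank-≡ i = trans (cong (λ r → suffixRank r xs i) (sym suct⊓t)) (suffixRank-⊓ (cap x ⊓ s) t xs i)

  left : Bool → ℕ → ℕ
  left b s = if b then pred s else s

  -- The proviso excludes taking an item with no slot free, where `pred` would truncate at 0 and the
  -- equivalence would fail.
  fits-∷ : ∀ s x xs b I → (T b → 0 < cap x ⊓ s) → Fits s (x ∷ xs) (b ∷ I) ⇔ Fits (left b (cap x ⊓ s)) xs I
  fits-∷ s x xs false I _   = fits-outside s x xs I
  fits-∷ s x xs true  I 0<s = fits-inside s x xs I (sym (suc-pred (cap x ⊓ s) {{>-nonZero (0<s _)}}))

  fits-⊥ : ∀ s xs → Fits s xs ⊥
  fits-⊥ s xs i = ≤-trans (∣p∩q∣≤∣p∣ ⊥ (suffix i)) (≤-trans (≤-reflexive (∣⊥∣≡0 (length xs))) z≤n)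

  fits-head : ∀ s x xs → Fits s (x ∷ xs) (⊥ ∪ ⁅ zero ⁆) ⇔ 0 < cap x ⊓ s
  fits-head s x xs = mk⇔ (λ fits → ≤-trans (s≤s z≤n) (fits zero)) from
    where
    from : 0 < cap x ⊓ s → Fits s (x ∷ xs) (⊥ ∪ ⁅ zero ⁆)
    from 0<s = Equivalence.from (fits-∷ s x xs true (⊥ ∪ ⊥) λ _ → 0<s)
      (subst (Fits _ xs) (sym (∪-identityˡ ⊥)) (fits-⊥ _ xs))

open ChainMatroid

-- Tables of natural numbers and the executable check.

module Tables where
  open import Data.Nat.Base
  open ≡ using (refl)

  at : List ℕ → ℕ → ℕ
  -- The default 0 makes `zeroTable` the zero function.
  at []       _       = 0
  at (a ∷ as) zero    = a
  at (a ∷ as) (suc s) = at as s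

  at-applyUpTo : ∀ f {n s} → s < n → at (applyUpTo f n) s ≡ f s
  at-applyUpTo f {suc n} {zero}  _         = refl
  at-applyUpTo f {suc n} {suc s} (s≤s s<n) = at-applyUpTo (f ∘ suc) s<n

  -- A rational-valued function on {0, …, 3} with a common denominator.
  data Table : Set where
    table : ℕ → List ℕ → Table

  scale : Table → ℕ
  scale (table N _) = N

  entry : Table → ℕ → ℕ
  entry (table _ as) = at as

  zeroTable : Table
  zeroTable = table 1 []

  accept : Item → Table → ℕ → ℕ
  accept x t zero    = entry t 0
  accept x t (suc s) = scale t * worth x + entry t s

  -- If t s bounds the reward from the later items given s free slots, then
  -- opened x t does so with x, accepted when it is nonzero, in front of them.
  openedEntry : Item → Table → ℕ → ℕ
  openedEntry x t s = accept x t (cap x ⊓ s) + odds x * entry t (cap x ⊓ s)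

  opened : Item → Table → Table
  opened x t = table (suc (odds x) * scale t) (applyUpTo (openedEntry x t) 4)

  everyIterate : ℕ → Item → (Table → Bool) → Table → Bool
  everyIterate zero    x P t = P t
  everyIterate (suc n) x P t = P t ∧ everyIterate n x P (opened x t)

  -- Trades the last iterate for a stronger predicate on the others: `P` holds with one more item in
  -- front, whether that item is closed or open.
  everyIterate-snoc : ∀ n {x P t} → T (everyIterate (suc n) x P t) →
                      T (everyIterate n x (λ u → P u ∧ P (opened x u)) t)
  everyIterate-snoc zero        p = p
  everyIterate-snoc (suc n) {x} {P} {t} p =
    let p₁ , q = Equivalence.to (T-∧ {P t}) p
        p₂ , _ = Equivalence.to (T-∧ {P (opened x t)}) q
    in Equivalence.from T-∧ (Equivalence.from T-∧ (p₁ , p₂) , everyIterate-snoc n q)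

  -- The number of open items in each block of identical items determines the profile.
  everyProfile : List (ℕ and Item) → (Table → Bool) → Bool
  everyProfile []             P = P zeroTable
  everyProfile ((n , x) ∷ bs) P = everyProfile bs (everyIterate n x P)

  expand : List (ℕ and Item) → List Item
  expand []             = []
  expand ((n , x) ∷ bs) = replicate n x ++ expand bs

  -- If t bounds from below a payoff that depends on the number c of later items
  -- chosen, then choose x s t does so for that payoff together with x, which is
  -- chosen if it is nonzero and c < s.
  chooseEntry : Item → ℕ → Table → ℕ → ℕ
  chooseEntry x s t c =
    (if c <ᵇ s then scale t * worth x + entry t (suc c) else entry t c) + odds x * entry t c

  choose : Item → ℕ → Table → Table
  choose x s t = table (suc (odds x) * scale t) (applyUpTo (chooseEntry x s t) 4)

  -- Runs from front to back although `best` decides from the back: the table holds the payoff of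
  -- the items passed so far, as a function of how many are chosen later.
  offline : ℕ → List Item → Table → Table
  offline s []       t = t
  offline s (x ∷ xs) t = offline (cap x ⊓ s) xs (choose x (cap x ⊓ s) t)

  -- The ratio inequality with denominators cleared: `entry t 3` over `scale t` bounds the reward
  -- from three free slots, `entry o 0` over `scale o` the optimum. The first conjunct makes the
  -- optimum positive.
  gap? : ℕ → ℕ → List (ℕ and Item) → Table → Bool
  gap? α β bs o = (0 <ᵇ entry o 0) ∧ everyProfile bs λ t →
    α * entry t 3 * scale o ≤ᵇ β * entry o 0 * scale t

open Tables

-- Ordered fields: natural multiples and reciprocals.

module OrderedFieldProperties {c ℓ₁ ℓ₂} (𝔽 : OrderedField c ℓ₁ ℓ₂) where
  open Prophet 𝔽
  open CommutativeRing commutativeRing public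
    using ( semiring; ring; +-monoid; +-commutativeMonoid; +-commutativeSemigroup
          ; *-commutativeSemigroup; +-assoc; +-comm
          ; +-cong; +-congˡ; +-congʳ; *-congˡ; *-congʳ; -‿cong
          ; +-identityˡ; +-identityʳ; *-identityˡ; *-assoc; distribˡ; zeroʳ; -‿inverseʳ )
    renaming (refl to ≈-refl; sym to ≈-sym; trans to ≈-trans; reflexive to ≈-reflexive)
  open DecTotalOrder decTotalOrder public
    using (poset; total; antisym) renaming (refl to ≤-refl; trans to ≤-trans; reflexive to ≤-reflexive)
  open import Algebra.Properties.Ring ring using (-‿distribˡ-*; -‿involutive)
  open import Algebra.Properties.Semiring.Mult semiring public
    using (×-congʳ; ×-congˡ; ×-homo-+; ×-assocˡ; ×-comm-*; ×-assoc-*; ×-homo-1)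
  open import Algebra.Properties.CommutativeMonoid.Mult +-commutativeMonoid public
    using (×-distrib-+)
  open import Algebra.Properties.Semiring.Sum semiring public using (*-distribˡ-sum; *-distribʳ-sum)
  open import Algebra.Properties.Monoid.Sum +-monoid public using (sum-cong-≋)
  open import Algebra.Properties.CommutativeMonoid.Sum +-commutativeMonoid public using (∑-distrib-+)
  import Algebra.Properties.CommutativeSemigroup as CommutativeSemigroupProperties
  module F+ = CommutativeSemigroupProperties +-commutativeSemigroup
  module F* = CommutativeSemigroupProperties *-commutativeSemigroup
  open import Relation.Binary.Reasoning.PartialOrder poset public

  +-mono-≤ : ∀ {w x y z} → w ≤ x → y ≤ z → w + y ≤ x + z
  +-mono-≤ {w} {x} {y} {z} w≤x y≤z = begin
    w + y  ≤⟨ +-monoˡ-≤ y w≤x ⟩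
    x + y  ≈⟨ +-comm x y ⟩
    y + x  ≤⟨ +-monoˡ-≤ x y≤z ⟩
    z + x  ≈⟨ +-comm z x ⟩
    x + z  ∎

  +-cancelʳ-≤ : ∀ z {x y} → x + z ≤ y + z → x ≤ y
  +-cancelʳ-≤ z {x} {y} p = begin
    x              ≈⟨ cancel x ⟨
    x + z + (- z)  ≤⟨ +-monoˡ-≤ (- z) p ⟩
    y + z + (- z)  ≈⟨ cancel y ⟩
    y              ∎
    where
    cancel : ∀ a → a + z + (- z) ≈ a
    cancel a = ≈-trans (+-assoc a z (- z)) (≈-trans (+-congˡ (-‿inverseʳ z)) (+-identityʳ a))

  ×-mono-≤ : ∀ n {x y} → x ≤ y → n × x ≤ n × y
  ×-mono-≤ zero    x≤y = ≤-refl
  ×-mono-≤ (suc n) x≤y = +-mono-≤ x≤y (×-mono-≤ n x≤y)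

  ×-cancel-≤ : ∀ n .{{_ : NonZero n}} {x y} → n × x ≤ n × y → x ≤ y
  ×-cancel-≤ (suc n) {x} {y} p with total x y
  ... | inj₁ x≤y = x≤y
  -- As `y ≤ x`, the summand `n × x` may be lowered to `n × y` and then cancelled.
  ... | inj₂ y≤x = +-cancelʳ-≤ (n × y) (≤-trans (+-mono-≤ ≤-refl (×-mono-≤ n y≤x)) p)

  0≤1 : 0# ≤ 1#
  0≤1 with total 0# 1#
  ... | inj₁ 0≤1 = 0≤1
  ... | inj₂ 1≤0 = begin
    0#             ≤⟨ *-nonneg 0≤-1 0≤-1 ⟩
    - 1# * - 1#    ≈⟨ -‿distribˡ-* 1# (- 1#) ⟨
    - (1# * - 1#)  ≈⟨ -‿cong (*-identityˡ (- 1#)) ⟩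
    - (- 1#)       ≈⟨ -‿involutive 1# ⟩
    1#             ∎
    where
    0≤-1 : 0# ≤ - 1#
    0≤-1 = begin
      0#         ≈⟨ -‿inverseʳ 1# ⟨
      1# + - 1#  ≤⟨ +-monoˡ-≤ (- 1#) 1≤0 ⟩
      0# + - 1#  ≈⟨ +-identityˡ (- 1#) ⟩
      - 1#       ∎

  1≰0 : ¬ (1# ≤ 0#)
  1≰0 1≤0 = 0≉1 (antisym 0≤1 1≤0)

  n×0≈0 : ∀ n → n × 0# ≈ 0#
  n×0≈0 zero    = ≈-refl
  n×0≈0 (suc n) = ≈-trans (+-identityˡ _) (n×0≈0 n)

  ι : ℕ → Carrier
  ι n = n × 1#

  ×-nonneg : ∀ n {x} → 0# ≤ x → 0# ≤ n × x
  ×-nonneg n 0≤x = ≤-trans (≤-reflexive (≈-sym (n×0≈0 n))) (×-mono-≤ n 0≤x)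

  ι-mono-≤ : ∀ {m n} → m ℕ.≤ n → ι m ≤ ι n
  ι-mono-≤ {n = n} ℕ.z≤n = ×-nonneg n 0≤1
  ι-mono-≤ (ℕ.s≤s m≤n)   = +-mono-≤ ≤-refl (ι-mono-≤ m≤n)

  ι-positive : ∀ n .{{_ : NonZero n}} → ¬ (ι n ≤ 0#)
  ι-positive (suc n) p = 1≰0 (≤-trans (≤-reflexive (≈-sym (×-homo-1 1#)))
    (≤-trans (ι-mono-≤ {1} {suc n} (ℕ.s≤s ℕ.z≤n)) p))

  ×ι : ∀ m n → m × ι n ≈ ι (m ℕ.* n)
  ×ι = ×-assocˡ 1#

  unit : ∀ n .{{_ : NonZero n}} → ∃ λ y → ι n * y ≈ 1#
  unit n = inverse (ι n) λ eq → ι-positive n (≤-reflexive eq)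

  1/suc : ℕ → Carrier
  1/suc n = let u , _ = unit (suc n) in u

  ×-1/suc : ∀ n → suc n × 1/suc n ≈ 1#
  ×-1/suc n = let u , eq = unit (suc n) in begin-equality
    suc n × u         ≈⟨ ×-congʳ (suc n) (*-identityˡ u) ⟨
    suc n × (1# * u)  ≈⟨ ×-assoc-* (suc n) 1# u ⟨
    ι (suc n) * u     ≈⟨ eq ⟩
    1#                ∎

  1/suc-nonneg : ∀ n → 0# ≤ 1/suc n
  1/suc-nonneg n = ×-cancel-≤ (suc n) (begin
    suc n × 0#       ≈⟨ n×0≈0 (suc n) ⟩
    0#               ≤⟨ 0≤1 ⟩
    1#               ≈⟨ ×-1/suc n ⟨
    suc n × 1/suc n  ∎)

  *-monoˡ-≤ : ∀ {x y z} → 0# ≤ x → y ≤ z → x * y ≤ x * z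
  *-monoˡ-≤ {x} {y} {z} 0≤x y≤z = +-cancelʳ-≤ (x * - y) (begin
    x * y + x * - y  ≈⟨ distribˡ x y (- y) ⟨
    x * (y + - y)    ≈⟨ *-congˡ (-‿inverseʳ y) ⟩
    x * 0#           ≈⟨ zeroʳ x ⟩
    0#               ≤⟨ *-nonneg 0≤x 0≤z-y ⟩
    x * (z + - y)    ≈⟨ distribˡ x z (- y) ⟩
    x * z + x * - y  ∎)
    where
    0≤z-y : 0# ≤ z + - y
    0≤z-y = ≤-trans (≤-reflexive (≈-sym (-‿inverseʳ y))) (+-monoˡ-≤ (- y) y≤z)

  sum-mono-≤ : ∀ {n} {f g : Fin n → Carrier} → (∀ i → f i ≤ g i) → sum f ≤ sum g
  sum-mono-≤ {zero}  f≤g = ≤-refl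
  sum-mono-≤ {suc n} f≤g = +-mono-≤ (f≤g zero) (sum-mono-≤ (f≤g ∘ suc))

  -- Monotonicity and linearity of expectation.

  𝔼-cong : ∀ {n} (D : Fin n → Distribution) {f g} → (∀ x → f x ≈ g x) → 𝔼 D f ≈ 𝔼 D g
  𝔼-cong {zero}  D f≈g = f≈g F.[]
  𝔼-cong {suc n} D f≈g = sum-cong-≋ {size} λ j → *-congˡ {prob j} (𝔼-cong (F.tail D) λ x → f≈g (value j F.∷ x))
    where open Distribution (F.head D)

  𝔼-mono : ∀ {n} (D : Fin n → Distribution) {f g} → (∀ x → f x ≤ g x) → 𝔼 D f ≤ 𝔼 D g
  𝔼-mono {zero}  D f≤g = f≤g F.[]
  𝔼-mono {suc n} D f≤g = sum-mono-≤ {size} λ j →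
    *-monoˡ-≤ (prob≥0 j) (𝔼-mono (F.tail D) λ x → f≤g (value j F.∷ x))
    where open Distribution (F.head D)

  𝔼-+ : ∀ {n} (D : Fin n → Distribution) f g → 𝔼 D (λ x → f x + g x) ≈ 𝔼 D f + 𝔼 D g
  𝔼-+ {zero}  D f g = ≈-refl
  𝔼-+ {suc n} D f g = ≈-trans
    (sum-cong-≋ {size} λ j → ≈-trans
      (*-congˡ (𝔼-+ (F.tail D) (f ∘ (value j F.∷_)) (g ∘ (value j F.∷_)))) (distribˡ _ _ _))
    (∑-distrib-+ (λ j → prob j * 𝔼 (F.tail D) (λ x → f (value j F.∷ x)))
                 (λ j → prob j * 𝔼 (F.tail D) (λ x → g (value j F.∷ x))))
    where open Distribution (F.head D)

  𝔼-* : ∀ {n} (D : Fin n → Distribution) k f → 𝔼 D (λ x → k * f x) ≈ k * 𝔼 D f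
  𝔼-* {zero}  D k f = ≈-refl
  𝔼-* {suc n} D k f = ≈-trans
    (sum-cong-≋ {size} λ j → ≈-trans (*-congˡ (𝔼-* (F.tail D) k (f ∘ (value j F.∷_)))) (F*.x∙yz≈y∙xz _ _ _))
    (≈-sym (*-distribˡ-sum k (λ j → prob j * 𝔼 (F.tail D) (λ x → f (value j F.∷ x)))))
    where
    open Distribution (F.head D)

  𝔼-const : ∀ {n} (D : Fin n → Distribution) k → 𝔼 D (λ _ → k) ≈ k
  𝔼-const {zero}  D k = ≈-refl
  𝔼-const {suc n} D k = begin-equality
    sum (λ j → prob j * 𝔼 (F.tail D) (λ _ → k))  ≈⟨ sum-cong-≋ {size} (λ j → *-congˡ (𝔼-const (F.tail D) k)) ⟩
    sum (λ j → prob j * k)                       ≈⟨ *-distribʳ-sum k prob ⟨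
    sum prob * k                                 ≈⟨ *-congʳ sum-prob ⟩
    1# * k                                       ≈⟨ *-identityˡ k ⟩
    k                                            ∎
    where open Distribution (F.head D)

-- Bernoulli laws and their means.

module ChainInstance {c ℓ₁ ℓ₂} (𝔽 : OrderedField c ℓ₁ ℓ₂) where
  open Prophet 𝔽
  open OrderedFieldProperties 𝔽
  open import Data.List.Extrema totalOrder using (v≤max⁺)

  law : Item → Distribution
  law x = record
    { size     = 2
    ; prob     = p F.∷ (odds x × p) F.∷ F.[]
    ; value    = ι (worth x) F.∷ 0# F.∷ F.[]
    ; prob≥0   = λ { zero → 1/suc-nonneg (odds x) ; (suc zero) → ×-nonneg (odds x) (1/suc-nonneg (odds x)) }
    ; value≥0  = λ { zero → ×-nonneg (worth x) 0≤1 ; (suc zero) → ≤-refl }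
    ; sum-prob = ≈-trans (+-congˡ (+-identityʳ _)) (×-1/suc (odds x))
    }
    where p = 1/suc (odds x)

  laws : (xs : List Item) → Fin (length xs) → Distribution
  laws xs i = law (List.lookup xs i)

  -- Expectation over a single item: `a` is the outcome at its nonzero value, `b` the outcome at 0.
  mean : Item → Carrier → Carrier → Carrier
  mean x a b = 1/suc (odds x) * a + (odds x × 1/suc (odds x)) * b

  ×-mean : ∀ x a b → suc (odds x) × mean x a b ≈ a + odds x × b
  ×-mean x a b = begin-equality
    suc d × (u * a + (d × u) * b)            ≈⟨ ×-distrib-+ _ _ (suc d) ⟩
    suc d × (u * a) + suc d × ((d × u) * b)  ≈⟨ +-cong (cancel a) right ⟩
    a + d × b                                ∎
    where
    d = odds x
    u = 1/suc d
    cancel : ∀ y → suc d × (u * y) ≈ y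
    cancel y = begin-equality
      suc d × (u * y)  ≈⟨ ×-assoc-* (suc d) u y ⟨
      (suc d × u) * y  ≈⟨ *-congʳ (×-1/suc d) ⟩
      1# * y           ≈⟨ *-identityˡ y ⟩
      y                ∎
    right : suc d × ((d × u) * b) ≈ d × b
    right = begin-equality
      suc d × ((d × u) * b)    ≈⟨ ×-congʳ (suc d) (≈-trans (×-assoc-* d u b) (≈-sym (×-comm-* d u b))) ⟩
      suc d × (u * (d × b))    ≈⟨ cancel (d × b) ⟩
      d × b                    ∎

  mean-cong : ∀ x {a a′ b b′} → a ≈ a′ → b ≈ b′ → mean x a b ≈ mean x a′ b′
  mean-cong x p q = +-cong (*-congˡ p) (*-congˡ q)

  mean-mono-≤ : ∀ x {a a′ b b′} → a ≤ a′ → b ≤ b′ → mean x a b ≤ mean x a′ b′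
  mean-mono-≤ x p q = +-mono-≤ (*-monoˡ-≤ (1/suc-nonneg (odds x)) p)
    (*-monoˡ-≤ (×-nonneg (odds x) (1/suc-nonneg (odds x))) q)

  mean-idem : ∀ x a → mean x a a ≈ a
  mean-idem x a = antisym (×-cancel-≤ (suc (odds x)) (≤-reflexive (×-mean x a a)))
                          (×-cancel-≤ (suc (odds x)) (≤-reflexive (≈-sym (×-mean x a a))))

  mean-+ : ∀ x a b k → mean x (a + k) (b + k) ≈ mean x a b + k
  mean-+ x a b k = begin-equality
    mean x (a + k) (b + k)                     ≈⟨ +-cong (distribˡ _ a k) (distribˡ _ b k) ⟩
    (p * a + p * k) + (q * b + q * k)          ≈⟨ F+.interchange (p * a) (p * k) (q * b) (q * k) ⟩
    mean x a b + mean x k k                    ≈⟨ +-congˡ (mean-idem x k) ⟩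
    mean x a b + k                             ∎
    where
    p = 1/suc (odds x)
    q = odds x × p

  𝔼-∷ : ∀ x xs f → 𝔼 (laws (x ∷ xs)) f ≈
        mean x (𝔼 (laws xs) λ X → f (ι (worth x) F.∷ X)) (𝔼 (laws xs) λ X → f (0# F.∷ X))
  𝔼-∷ x xs f = +-congˡ (+-identityʳ _)

  𝔼-mean : ∀ {n} (D : Fin n → Distribution) x f g →
           𝔼 D (λ X → mean x (f X) (g X)) ≈ mean x (𝔼 D f) (𝔼 D g)
  𝔼-mean D x f g = ≈-trans (𝔼-+ D _ _) (+-cong (𝔼-* D _ f) (𝔼-* D _ g))

  ×ι+ : ∀ m n k → m × ι n + ι k ≈ ι (m ℕ.* n ℕ.+ k)
  ×ι+ m n k = ≈-trans (+-congʳ (×ι m n)) (≈-sym (×-homo-+ 1# (m ℕ.* n) k))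

  -- The factor `suc (odds x)` clears the probability of the item; what is left is the recurrence
  -- that `opened` and `choose` compute.
  scaled-mean : ∀ x N a b → (suc (odds x) ℕ.* N) × mean x a b ≈ N × a + odds x × (N × b)
  scaled-mean x N a b = begin-equality
    (suc d ℕ.* N) × mean x a b  ≈⟨ ×-congˡ (ℕₚ.*-comm (suc d) N) ⟩
    (N ℕ.* suc d) × mean x a b  ≈⟨ ×-assocˡ _ N (suc d) ⟨
    N × (suc d × mean x a b)    ≈⟨ ×-congʳ N (×-mean x a b) ⟩
    N × (a + d × b)             ≈⟨ ×-distrib-+ a (d × b) N ⟩
    N × a + N × (d × b)         ≈⟨ +-congˡ (≈-trans (×-assocˡ b N d)
                                     (≈-trans (×-congˡ (ℕₚ.*-comm N d)) (≈-sym (×-assocˡ b d N)))) ⟩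
    N × a + d × (N × b)         ∎
    where d = odds x

  scaled-mean-≤ : ∀ x N {a b} m n → N × a ≤ ι m → N × b ≤ ι n →
                  (suc (odds x) ℕ.* N) × mean x a b ≤ ι (m ℕ.+ odds x ℕ.* n)
  scaled-mean-≤ x N {a} {b} m n p q = begin
    (suc (odds x) ℕ.* N) × mean x a b  ≈⟨ scaled-mean x N a b ⟩
    N × a + odds x × (N × b)           ≤⟨ +-mono-≤ p (×-mono-≤ (odds x) q) ⟩
    ι m + odds x × ι n                 ≈⟨ +-congˡ (×ι (odds x) n) ⟩
    ι m + ι (odds x ℕ.* n)             ≈⟨ ×-homo-+ 1# m (odds x ℕ.* n) ⟨
    ι (m ℕ.+ odds x ℕ.* n)             ∎

  scaled-mean-≥ : ∀ x N {a b} m n → ι m ≤ N × a → ι n ≤ N × b →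
                  ι (m ℕ.+ odds x ℕ.* n) ≤ (suc (odds x) ℕ.* N) × mean x a b
  scaled-mean-≥ x N {a} {b} m n p q = begin
    ι (m ℕ.+ odds x ℕ.* n)             ≈⟨ ×-homo-+ 1# m (odds x ℕ.* n) ⟩
    ι m + ι (odds x ℕ.* n)             ≈⟨ +-congˡ (×ι (odds x) n) ⟨
    ι m + odds x × ι n                 ≤⟨ +-mono-≤ p (×-mono-≤ (odds x) q) ⟩
    N × a + odds x × (N × b)           ≈⟨ scaled-mean x N a b ⟨
    (suc (odds x) ℕ.* N) × mean x a b  ∎

  -- The online algorithm as a recursion on free slots.

  -- The step local to `accepted`, given a name so that runs on different matroids can be compared.
  step : ∀ {n} → LaminarMatroid n → (Fin n → Threshold) → (Fin n → Carrier) →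
         Subset n → Fin n → Subset n
  step M Th X S i =
    if meets (Th i) (X i) ∧ does (LaminarMatroid.independent? M (S ∪ ⁅ i ⁆)) then S ∪ ⁅ i ⁆ else S

  -- Once the first item is settled as `b`, each later step only queries independence of sets with
  -- head `b`, and there `M` and `M′` agree.
  foldl-step-suc : ∀ {n} (M : LaminarMatroid (suc n)) (M′ : LaminarMatroid n) Th X b →
    (∀ I → does (LaminarMatroid.independent? M (b ∷ I)) ≡ does (LaminarMatroid.independent? M′ I)) →
    ∀ S is → foldl (step M Th X) (b ∷ S) (List.map suc is) ≡
             b ∷ foldl (step M′ (F.tail Th) (F.tail X)) S is
  foldl-step-suc M M′ Th X b same S []       = ≡.refl
  foldl-step-suc {n} M M′ Th X b same S (i ∷ is) =
    ≡.trans (≡.cong (λ R → foldl (step M Th X) R (List.map suc is)) (step-suc b same))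
            (foldl-step-suc M M′ Th X b same _ is)
    where
    branch : ∀ m {r r′} b {R S : Subset n} → r ≡ r′ →
             (if m ∧ r then b ∷ R else b ∷ S) ≡ b ∷ (if m ∧ r′ then R else S)
    branch false         b ≡.refl = ≡.refl
    branch true  {false} b ≡.refl = ≡.refl
    branch true  {true}  b ≡.refl = ≡.refl
    step-suc : ∀ b → (∀ I → does (LaminarMatroid.independent? M (b ∷ I)) ≡
                            does (LaminarMatroid.independent? M′ I)) →
               step M Th X (b ∷ S) (suc i) ≡ b ∷ step M′ (F.tail Th) (F.tail X) S i
    -- Splitting on `b` lets the head of `(b ∷ S) ∪ ⁅ suc i ⁆` compute to `b`.
    step-suc false same = branch (meets (Th (suc i)) (X (suc i))) false (same (S ∪ ⁅ i ⁆))
    step-suc true  same = branch (meets (Th (suc i)) (X (suc i))) true (same (S ∪ ⁅ i ⁆))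

  takes : Bool → ℕ → Bool
  takes m s = m ∧ (0 <ᵇ s)

  takes⇒0< : ∀ m s → T (takes m s) → 0 ℕ.< s
  takes⇒0< true (suc s) _ = ℕ.s≤s ℕ.z≤n

  -- By `fits-head` the first item gets in when its threshold is met and a slot is free; by `fits-∷`
  -- the rest is a run on the shorter chain with the slots left.
  accepted-∷ : ∀ s x xs Th X → let b = takes (meets (Th zero) (X zero)) (cap x ⊓ s) in
    accepted (chain s (x ∷ xs)) Th X ≡ b ∷ accepted (chain (left b (cap x ⊓ s)) xs) (F.tail Th) (F.tail X)
  accepted-∷ s x xs Th X = all-steps
    where
    m = meets (Th zero) (X zero)
    b = takes m (cap x ⊓ s)
    M = chain s (x ∷ xs)
    M′ = chain (left b (cap x ⊓ s)) xs
    branch : ∀ m r {r′} → r′ ≡ r →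
             (if m ∧ r′ then ⊥ ∪ ⁅ zero {n = length xs} ⁆ else ⊥) ≡ (m ∧ r) ∷ ⊥
    branch false r     ≡.refl = ≡.refl
    branch true  false ≡.refl = ≡.refl
    branch true  true  ≡.refl = ≡.cong (inside ∷_) (∪-identityˡ ⊥)
    head : step M Th X ⊥ zero ≡ b ∷ ⊥
    head = branch m (0 <ᵇ cap x ⊓ s) (does-⇔ (fits-head s x xs)
      (LaminarMatroid.independent? M (⊥ ∪ ⁅ zero ⁆)) (0 ℕₚ.<? cap x ⊓ s))
    all-steps : accepted M Th X ≡ b ∷ accepted M′ (F.tail Th) (F.tail X)
    all-steps = ≡.trans
      (≡.cong₂ (foldl (step M Th X)) head (≡.sym (map-tabulate id suc)))
      (foldl-step-suc M M′ Th X b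
        (λ I → does-⇔ (fits-∷ s x xs b I (takes⇒0< m (cap x ⊓ s)))
          (LaminarMatroid.independent? M (b ∷ I)) (LaminarMatroid.independent? M′ I))
        ⊥ (allFin (length xs)))

  reward : ∀ xs → ℕ → (Fin (length xs) → Threshold) → Carrier
  reward xs s Th = 𝔼 (laws xs) λ X → weight (accepted (chain s xs) Th X) X

  gain : Bool → ℕ → Carrier → (ℕ → Carrier) → Carrier
  gain m s a R = (if takes m s then a else 0#) + R (left (takes m s) s)

  -- The first decision depends only on the first value, so given that value the remaining
  -- expectation is again a reward.
  reward-∷ : ∀ x xs s Th → let R s = reward xs s (F.tail Th) ; s′ = cap x ⊓ s in
    reward (x ∷ xs) s Th ≈ mean x (gain (meets (Th zero) (ι (worth x))) s′ (ι (worth x)) R)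
                                  (gain (meets (Th zero) 0#) s′ 0# R)
  reward-∷ x xs s Th = ≈-trans
    (𝔼-∷ x xs λ X → weight (accepted (chain s (x ∷ xs)) Th X) X)
    (mean-cong x (given (ι (worth x))) (given 0#))
    where
    given : ∀ a → 𝔼 (laws xs) (λ X → weight (accepted (chain s (x ∷ xs)) Th (a F.∷ X)) (a F.∷ X)) ≈
                  gain (meets (Th zero) a) (cap x ⊓ s) a (λ s → reward xs s (F.tail Th))
    given a = begin-equality
      𝔼 (laws xs) (λ X → weight (accepted (chain s (x ∷ xs)) Th (a F.∷ X)) (a F.∷ X))
        ≈⟨ 𝔼-cong (laws xs) (λ X → ≈-reflexive
             (≡.cong (λ S → weight S (a F.∷ X)) (accepted-∷ s x xs Th (a F.∷ X)))) ⟩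
      𝔼 (laws xs) (λ X → (if b then a else 0#) + weight (accepted (chain s″ xs) (F.tail Th) X) X)
        ≈⟨ 𝔼-+ (laws xs) _ _ ⟩
      𝔼 (laws xs) (λ _ → if b then a else 0#) + reward xs s″ (F.tail Th)
        ≈⟨ +-congʳ (𝔼-const (laws xs) _) ⟩
      (if b then a else 0#) + reward xs s″ (F.tail Th)  ∎
      where
      b = takes (meets (Th zero) a) (cap x ⊓ s)
      s″ = left b (cap x ⊓ s)

  gain-mono-≤ : ∀ m {s t a R} → 0# ≤ a → (∀ {s t} → s ℕ.≤ t → R s ≤ R t) → s ℕ.≤ t →
                gain m s a R ≤ gain m t a R
  gain-mono-≤ false                   _   R-mono s≤t           = +-mono-≤ ≤-refl (R-mono s≤t)
  gain-mono-≤ true  {zero}  {zero}    _   R-mono s≤t           = ≤-refl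
  gain-mono-≤ true  {zero}  {suc t}   0≤a R-mono s≤t           = +-mono-≤ 0≤a (R-mono ℕ.z≤n)
  gain-mono-≤ true  {suc s} {suc t}   0≤a R-mono (ℕ.s≤s s≤t)   = +-mono-≤ ≤-refl (R-mono s≤t)

  -- For fixed thresholds an extra slot never hurts: a run that has more slots stays ahead, or
  -- spends the surplus on an item of nonnegative value.
  reward-mono-≤ : ∀ xs Th {s t} → s ℕ.≤ t → reward xs s Th ≤ reward xs t Th
  reward-mono-≤ []       Th         _   = ≤-refl
  reward-mono-≤ (x ∷ xs) Th {s} {t} s≤t = begin
    reward (x ∷ xs) s Th  ≈⟨ reward-∷ x xs s Th ⟩
    _                     ≤⟨ mean-mono-≤ x
      (gain-mono-≤ (meets (Th zero) _) (×-nonneg (worth x) 0≤1) (reward-mono-≤ xs (F.tail Th)) s′≤t′)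
      (gain-mono-≤ (meets (Th zero) 0#) ≤-refl (reward-mono-≤ xs (F.tail Th)) s′≤t′) ⟩
    _                     ≈⟨ reward-∷ x xs t Th ⟨
    reward (x ∷ xs) t Th  ∎
    where s′≤t′ = ℕₚ.⊓-monoʳ-≤ (cap x) s≤t

  -- Accepting the value 0 earns nothing and can only cost a slot.
  gain-0-≤ : ∀ m s R → (∀ {s t} → s ℕ.≤ t → R s ≤ R t) → gain m s 0# R ≤ R s
  gain-0-≤ false s       R R-mono = ≤-reflexive (+-identityˡ _)
  gain-0-≤ true  zero    R R-mono = ≤-reflexive (+-identityˡ _)
  gain-0-≤ true  (suc s) R R-mono = ≤-trans (≤-reflexive (+-identityˡ _)) (R-mono (ℕₚ.n≤1+n s))

  -- Tables as upper bounds on the reward.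

  record Bounds (t : Table) (xs : List Item) (Th : Fin (length xs) → Threshold) : Set ℓ₂ where
    constructor bounds
    field
      scale≢0  : NonZero (scale t)
      reward-≤ : ∀ s → s ℕ.≤ 3 → scale t × reward xs s Th ≤ ι (entry t s)

  -- An item whose nonzero value is rejected earns nothing and creates no slots, so the table for
  -- the later items still serves.
  bounds-closed : ∀ {t} x xs Th → meets (Th zero) (ι (worth x)) ≡ false →
                  Bounds t xs (F.tail Th) → Bounds t (x ∷ xs) Th
  bounds-closed {t} x xs Th closed (bounds N≢0 ≤t) =
    bounds N≢0 λ s s≤3 → ≤-trans (×-mono-≤ (scale t) (begin
    reward (x ∷ xs) s Th       ≈⟨ reward-∷ x xs s Th ⟩
    mean x _ _                 ≤⟨ mean-mono-≤ x (≤-reflexive (value≈ s))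
                                                (gain-0-≤ (meets (Th zero) 0#) (cap x ⊓ s) R R-mono) ⟩
    mean x (R (cap x ⊓ s)) (R (cap x ⊓ s))  ≈⟨ mean-idem x _ ⟩
    R (cap x ⊓ s)              ≤⟨ R-mono (ℕₚ.m⊓n≤n (cap x) s) ⟩
    R s                        ∎)) (≤t s s≤3)
    where
    R : ℕ → Carrier
    R s = reward xs s (F.tail Th)
    R-mono : ∀ {s t} → s ℕ.≤ t → R s ≤ R t
    R-mono = reward-mono-≤ xs (F.tail Th)
    value≈ : ∀ s → gain (meets (Th zero) (ι (worth x))) (cap x ⊓ s) (ι (worth x)) R ≈ R (cap x ⊓ s)
    value≈ s rewrite closed = +-identityˡ _

  bounds-open : ∀ {t} x xs Th → meets (Th zero) (ι (worth x)) ≡ true →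
                Bounds t xs (F.tail Th) → Bounds (opened x t) (x ∷ xs) Th
  bounds-open {t} x xs Th open′ (bounds N≢0 ≤t) =
    bounds (ℕₚ.m*n≢0 (suc (odds x)) (scale t) {{_}} {{N≢0}}) λ s s≤3 → begin
      (suc (odds x) ℕ.* N) × reward (x ∷ xs) s Th  ≈⟨ ×-congʳ (suc (odds x) ℕ.* N) (reward-∷ x xs s Th) ⟩
      (suc (odds x) ℕ.* N) × mean x _ _            ≤⟨ scaled-mean-≤ x N
        (accept x t (cap x ⊓ s)) (entry t (cap x ⊓ s))
        (value-≤ (cap x ⊓ s) (⊓≤3 s≤3))
        (≤-trans (×-mono-≤ N (gain-0-≤ (meets (Th zero) 0#) (cap x ⊓ s) R
                               (reward-mono-≤ xs (F.tail Th))))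
                 (≤t (cap x ⊓ s) (⊓≤3 s≤3))) ⟩
      ι (accept x t (cap x ⊓ s) ℕ.+ odds x ℕ.* entry t (cap x ⊓ s))
        ≈⟨ ×-congˡ (at-applyUpTo (openedEntry x t) (ℕ.s≤s s≤3)) ⟨
      ι (entry (opened x t) s)  ∎
    where
    N = scale t
    R : ℕ → Carrier
    R s = reward xs s (F.tail Th)
    ⊓≤3 : ∀ {s} → s ℕ.≤ 3 → cap x ⊓ s ℕ.≤ 3
    ⊓≤3 {s} s≤3 = ℕₚ.≤-trans (ℕₚ.m⊓n≤n (cap x) s) s≤3
    value-≤ : ∀ s → s ℕ.≤ 3 → N × gain (meets (Th zero) (ι (worth x))) s (ι (worth x)) R ≤ ι (accept x t s)
    value-≤ s s≤3 rewrite open′ = by-slots s s≤3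
      where
      by-slots : ∀ s → s ℕ.≤ 3 → N × gain true s (ι (worth x)) R ≤ ι (accept x t s)
      by-slots zero    s≤3 = ≤-trans (≤-reflexive (×-congʳ N (+-identityˡ _))) (≤t 0 s≤3)
      by-slots (suc s) s≤3 = begin
        N × (ι (worth x) + R s)          ≈⟨ ×-distrib-+ _ _ N ⟩
        N × ι (worth x) + N × R s        ≤⟨ +-mono-≤ ≤-refl (≤t s (ℕₚ.≤-trans (ℕₚ.n≤1+n s) s≤3)) ⟩
        N × ι (worth x) + ι (entry t s)  ≈⟨ ×ι+ N (worth x) (entry t s) ⟩
        ι (accept x t (suc s))           ∎

  -- All that is used of a threshold is whether it admits the nonzero value, so two tables cover
  -- every choice.
  bounds-∷ : ∀ {t} x xs Th (P : Table → Bool) → T (P t ∧ P (opened x t)) → Bounds t xs (F.tail Th) →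
             ∃ λ u → T (P u) and Bounds u (x ∷ xs) Th
  bounds-∷ {t} x xs Th P ok bd with meets (Th zero) (ι (worth x)) in eq | Equivalence.to (T-∧ {P t}) ok
  ... | false | ok₁ , _   = _ , ok₁ , bounds-closed x xs Th eq bd
  ... | true  | _   , ok₂ = _ , ok₂ , bounds-open x xs Th eq bd

  -- Tables grow from the back, so the first item of the block is added last. The induction
  -- therefore runs over the other items with `P` strengthened to allow for either fate of the
  -- first.
  bounds-replicate : ∀ n {x ys} P →
    (∀ Th → ∃ λ t → T (everyIterate n x P t) and Bounds t ys Th) →
    ∀ Th → ∃ λ t → T (P t) and Bounds t (replicate n x ++ ys) Th
  bounds-replicate zero        P bound Th = bound Th
  bounds-replicate (suc n) {x} P bound Th =
    let t , ok , bd = bounds-replicate n (λ u → P u ∧ P (opened x u))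
                        (λ Th′ → let t , ok , bd = bound Th′ in t , everyIterate-snoc n ok , bd) (F.tail Th)
    in bounds-∷ x _ Th P ok bd

  bounds-expand : ∀ bs P → T (everyProfile bs P) → ∀ Th →
                  ∃ λ t → T (P t) and Bounds t (expand bs) Th
  bounds-expand []             P ok Th = zeroTable , ok , bounds _ λ s _ → ≤-reflexive (+-identityʳ 0#)
  bounds-expand ((n , x) ∷ bs) P ok Th = bounds-replicate n P (bounds-expand bs (everyIterate n x P) ok) Th

  -- A lower bound on the optimum from a backward greedy choice.

  active : Carrier → Bool
  active a = not (does (a ≤? 0#))

  active-0 : active 0# ≡ false
  active-0 = ≡.cong not (dec-true (0# ≤? 0#) ≤-refl)

  active-ι : ∀ x → active (ι (worth x)) ≡ true
  active-ι x = ≡.cong not (dec-false (ι (worth x) ≤? 0#) (ι-positive (worth x)))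

  -- Optimal for worths that increase along the chain, but only a lower bound is needed.
  best : ∀ s xs → (Fin (length xs) → Carrier) → Subset (length xs)
  best s []       X = []
  best s (x ∷ xs) X = let I = best (cap x ⊓ s) xs (F.tail X) in
    (active (F.head X) ∧ (∣ I ∣ <ᵇ cap x ⊓ s)) ∷ I

  best-fits : ∀ s xs X → Fits s xs (best s xs X)
  best-fits s []       X = λ ()
  best-fits s (x ∷ xs) X = by-head (active (F.head X))
    where
    I = best (cap x ⊓ s) xs (F.tail X)
    fits : Fits (cap x ⊓ s) xs I
    fits = best-fits (cap x ⊓ s) xs (F.tail X)
    by-room : ∀ b → (T b → ∣ I ∣ ℕ.< cap x ⊓ s) → Fits s (x ∷ xs) (b ∷ I)
    by-room false _    = Equivalence.from (fits-outside s x xs I) fits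
    by-room true  room = fits-inside⁺ s x xs I (room _) fits
    by-head : ∀ m → Fits s (x ∷ xs) ((m ∧ (∣ I ∣ <ᵇ cap x ⊓ s)) ∷ I)
    by-head false = by-room false λ ()
    by-head true  = by-room (∣ I ∣ <ᵇ cap x ⊓ s) (ℕₚ.<ᵇ⇒< ∣ I ∣ (cap x ⊓ s))

  weight≤opt : ∀ {n} (M : LaminarMatroid n) I X → LaminarMatroid.Independent M I → weight I X ≤ opt M X
  weight≤opt M I X ind = v≤max⁺ 0# _ (inj₂ (lose (∈-map⁺ (λ J → weight J X)
    (∈-filter⁺ (LaminarMatroid.independent? M) (∈-subsets I) ind)) ≤-refl))

  -- Here `h` stands for what the items in front contribute, given the number chosen from `xs`.
  payoff : ∀ s xs → (ℕ → Carrier) → (Fin (length xs) → Carrier) → Carrier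
  payoff s xs h X = h ∣ best s xs X ∣ + weight (best s xs X) X

  -- The field-valued counterpart of `chooseEntry`.
  chosen : Item → ℕ → (ℕ → Carrier) → ℕ → Carrier
  chosen x s h c = mean x (if c <ᵇ s then ι (worth x) + h (suc c) else h c) (h c)

  -- Whether `best` takes `x` depends only on the value of `x` and the number of later choices.
  -- Averaging over `x` first thus turns its contribution into a function of that number.
  payoff-∷ : ∀ s x xs h → 𝔼 (laws (x ∷ xs)) (payoff s (x ∷ xs) h) ≈
             𝔼 (laws xs) (payoff (cap x ⊓ s) xs (chosen x (cap x ⊓ s) h))
  payoff-∷ s x xs h = begin-equality
    𝔼 (laws (x ∷ xs)) (payoff s (x ∷ xs) h)
      ≈⟨ 𝔼-∷ x xs (payoff s (x ∷ xs) h) ⟩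
    mean x (𝔼 (laws xs) λ X → payoff s (x ∷ xs) h (ι (worth x) F.∷ X))
           (𝔼 (laws xs) λ X → payoff s (x ∷ xs) h (0# F.∷ X))
      ≈⟨ 𝔼-mean (laws xs) x (λ X → payoff s (x ∷ xs) h (ι (worth x) F.∷ X))
                            (λ X → payoff s (x ∷ xs) h (0# F.∷ X)) ⟨
    𝔼 (laws xs) (λ X → mean x (payoff s (x ∷ xs) h (ι (worth x) F.∷ X)) (payoff s (x ∷ xs) h (0# F.∷ X)))
      ≈⟨ 𝔼-cong (laws xs) pointwise ⟩
    𝔼 (laws xs) (payoff s′ xs (chosen x s′ h))  ∎
    where
    s′ = cap x ⊓ s
    module _ (X : Fin (length xs) → Carrier) where
      I = best s′ xs X
      W = weight I X
      when-active : payoff s (x ∷ xs) h (ι (worth x) F.∷ X) ≈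
                    (if ∣ I ∣ <ᵇ s′ then ι (worth x) + h (suc ∣ I ∣) else h ∣ I ∣) + W
      when-active rewrite active-ι x with ∣ I ∣ <ᵇ s′
      ... | false = +-congˡ (+-identityˡ W)
      ... | true  = ≈-trans (≈-sym (+-assoc _ _ W)) (+-congʳ (+-comm _ _))
      when-zero : payoff s (x ∷ xs) h (0# F.∷ X) ≈ h ∣ I ∣ + W
      when-zero rewrite active-0 = +-congˡ (+-identityˡ W)
      pointwise : mean x (payoff s (x ∷ xs) h (ι (worth x) F.∷ X)) (payoff s (x ∷ xs) h (0# F.∷ X)) ≈
                  payoff s′ xs (chosen x s′ h) X
      pointwise = ≈-trans (mean-cong x when-active when-zero) (mean-+ x _ _ W)

  Minorises : Table → (ℕ → Carrier) → Set ℓ₂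
  Minorises t h = ∀ c → c ℕ.≤ 3 → ι (entry t c) ≤ scale t × h c

  choose-minorises : ∀ x {s} t h → s ℕ.≤ 3 → Minorises t h → Minorises (choose x s t) (chosen x s h)
  choose-minorises x {s} t h s≤3 t≤h c c≤3 = begin
    ι (entry (choose x s t) c)
      ≈⟨ ×-congˡ (at-applyUpTo (chooseEntry x s t) (ℕ.s≤s c≤3)) ⟩
    ι (chooseEntry x s t c)
      ≤⟨ scaled-mean-≥ x N (if c <ᵇ s then _ else _) (entry t c) value-≤ (t≤h c c≤3) ⟩
    (suc (odds x) ℕ.* N) × chosen x s h c  ∎
    where
    N = scale t
    value-≤ : ι (if c <ᵇ s then N ℕ.* worth x ℕ.+ entry t (suc c) else entry t c) ≤
              N × (if c <ᵇ s then ι (worth x) + h (suc c) else h c)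
    value-≤ with c <ᵇ s in eq
    ... | false = t≤h c c≤3
    -- From `c < s` and `s ≤ 3` the index `suc c` is still at most 3, where the table is known to
    -- minorise `h`.
    ... | true  = begin
      ι (N ℕ.* worth x ℕ.+ entry t (suc c))  ≈⟨ ×ι+ N (worth x) _ ⟨
      N × ι (worth x) + ι (entry t (suc c))  ≤⟨ +-mono-≤ ≤-refl (t≤h (suc c) (ℕₚ.≤-trans
                                                  (ℕₚ.<ᵇ⇒< c s (Equivalence.from T-≡ eq)) s≤3)) ⟩
      N × ι (worth x) + N × h (suc c)        ≈⟨ ×-distrib-+ _ _ N ⟨
      N × (ι (worth x) + h (suc c))          ∎

  -- Each item is absorbed into the payoff in turn. When none is left the number of later choices is
  -- 0, hence the entry at 0.
  offline-≤ : ∀ s xs t h → s ℕ.≤ 3 → Minorises t h → let u = offline s xs t in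
              ι (entry u 0) ≤ scale u × 𝔼 (laws xs) (payoff s xs h)
  offline-≤ s []       t h s≤3 t≤h = ≤-trans (t≤h 0 ℕ.z≤n)
    (≤-reflexive (×-congʳ (scale t) (≈-sym (+-identityʳ (h 0)))))
  offline-≤ s (x ∷ xs) t h s≤3 t≤h = ≤-trans
    (offline-≤ (cap x ⊓ s) xs _ _ s′≤3 (choose-minorises x t h s′≤3 t≤h))
    (≤-reflexive (×-congʳ (scale (offline s (x ∷ xs) t)) (≈-sym (payoff-∷ s x xs h))))
    where s′≤3 = ℕₚ.≤-trans (ℕₚ.m⊓n≤n (cap x) s) s≤3

  offline-scale≢0 : ∀ s xs t → NonZero (scale t) → NonZero (scale (offline s xs t))
  offline-scale≢0 s []       t t≢0 = t≢0
  offline-scale≢0 s (x ∷ xs) t t≢0 =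
    offline-scale≢0 _ xs _ (ℕₚ.m*n≢0 (suc (odds x)) (scale t) {{_}} {{t≢0}})

  -- From the check on natural numbers to the competitive ratio.

  chainInstance : List Item → Instance
  chainInstance xs = record { n = length xs ; matroid = chain 3 xs ; law = laws xs }

  offline-≤-𝔼OPT : ∀ xs → let u = offline 3 xs zeroTable in
                   ι (entry u 0) ≤ scale u × 𝔼OPT (chainInstance xs)
  offline-≤-𝔼OPT xs = ≤-trans
    (offline-≤ 3 xs zeroTable (λ _ → 0#) ℕₚ.≤-refl λ c _ → ≤-reflexive (≈-sym (+-identityʳ 0#)))
    (×-mono-≤ (scale (offline 3 xs zeroTable)) (𝔼-mono (laws xs) λ X →
      ≤-trans (≤-reflexive (+-identityˡ _)) (weight≤opt (chain 3 xs) (best 3 xs X) X (best-fits 3 xs X))))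

  cross-multiply : ∀ α β {N M a b} .{{_ : NonZero N}} .{{_ : NonZero M}} {x y} →
                   N × x ≤ ι a → ι b ≤ M × y → α ℕ.* a ℕ.* M ℕ.≤ β ℕ.* b ℕ.* N → α × x ≤ β × y
  cross-multiply α β {N} {M} {a} {b} {x} {y} x≤ ≤y le = ×-cancel-≤ (N ℕ.* M) {{ℕₚ.m*n≢0 N M}} (begin
    (N ℕ.* M) × (α × x)        ≈⟨ ×-assocˡ x (N ℕ.* M) α ⟩
    (N ℕ.* M ℕ.* α) × x        ≈⟨ ×-congˡ (ℕ*.xy∙z≈zy∙x N M α) ⟩
    (α ℕ.* M ℕ.* N) × x        ≈⟨ ×-assocˡ x (α ℕ.* M) N ⟨
    (α ℕ.* M) × (N × x)        ≤⟨ ×-mono-≤ (α ℕ.* M) x≤ ⟩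
    (α ℕ.* M) × ι a            ≈⟨ ×ι (α ℕ.* M) a ⟩
    ι (α ℕ.* M ℕ.* a)          ≤⟨ ι-mono-≤ (≡.subst₂ ℕ._≤_ (ℕ*.xy∙z≈xz∙y α a M) (ℕ*.xy∙z≈xz∙y β b N) le) ⟩
    ι (β ℕ.* N ℕ.* b)          ≈⟨ ×ι (β ℕ.* N) b ⟨
    (β ℕ.* N) × ι b            ≤⟨ ×-mono-≤ (β ℕ.* N) ≤y ⟩
    (β ℕ.* N) × (M × y)        ≈⟨ ×-assocˡ y (β ℕ.* N) M ⟩
    (β ℕ.* N ℕ.* M) × y        ≈⟨ ×-congˡ (≡.trans (ℕₚ.*-assoc β N M) (ℕₚ.*-comm β (N ℕ.* M))) ⟩
    (N ℕ.* M ℕ.* β) × y        ≈⟨ ×-assocˡ y (N ℕ.* M) β ⟨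
    (N ℕ.* M) × (β × y)        ∎)

  -- Thresholds are drawn independently of the values, so randomisation cannot
  -- beat the best deterministic choice.
  𝔼ALG-≤ : ∀ {a b} I (A : NonAdaptive a b I) α .{{_ : NonZero α}} {y} →
           (∀ Th → α × 𝔼reward I Th ≤ y) → α × 𝔼ALG I A ≤ y
  𝔼ALG-≤ I A α@(suc d) {y} bound = begin
    α × 𝔼ALG I A    ≤⟨ ×-mono-≤ α (∫-mono integrable (const-int k) λ ω →
                         ×-cancel-≤ α (≤-trans (bound (threshold ω)) (≤-reflexive (≈-sym αk≈y)))) ⟩
    α × ∫ _ (const-int k)  ≈⟨ ×-congʳ α (∫-const k (const-int k)) ⟩
    α × k           ≈⟨ αk≈y ⟩
    y               ∎
    where
    open NonAdaptive A
    k = 1/suc d * y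
    αk≈y : α × k ≈ y
    αk≈y = begin-equality
      α × (1/suc d * y)  ≈⟨ ×-assoc-* α (1/suc d) y ⟨
      (α × 1/suc d) * y  ≈⟨ *-congʳ (×-1/suc d) ⟩
      1# * y             ≈⟨ *-identityˡ y ⟩
      y                  ∎

  -- The hypothesis mentions natural numbers only, so a single evaluation serves every ordered
  -- field.
  gap⇒instance : ∀ {a b} α .{{_ : NonZero α}} β bs → T (gap? α β bs (offline 3 (expand bs) zeroTable)) →
    let I = chainInstance (expand bs) in
    (0# < 𝔼OPT I) and (∀ (A : NonAdaptive a b I) → α × 𝔼ALG I A ≤ β × 𝔼OPT I)
  gap⇒instance α β bs ok = 0<𝔼OPT , λ A → 𝔼ALG-≤ _ A α deterministic
    where
    o = offline 3 (expand bs) zeroTable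
    P : Table → Bool
    P t = α ℕ.* entry t 3 ℕ.* scale o ℕ.≤ᵇ β ℕ.* entry o 0 ℕ.* scale t
    checks : T (0 <ᵇ entry o 0) and T (everyProfile bs P)
    checks = Equivalence.to T-∧ ok
    0<𝔼OPT : 0# < 𝔼OPT (chainInstance (expand bs))
    0<𝔼OPT opt≤0 = let pos , _ = checks in ι-positive (entry o 0) {{ℕ.>-nonZero (ℕₚ.<ᵇ⇒< 0 _ pos)}} (begin
      ι (entry o 0)                                ≤⟨ offline-≤-𝔼OPT (expand bs) ⟩
      scale o × 𝔼OPT (chainInstance (expand bs))  ≤⟨ ×-mono-≤ (scale o) opt≤0 ⟩
      scale o × 0#                                 ≈⟨ n×0≈0 (scale o) ⟩
      0#                                           ∎)
    deterministic : ∀ Th → α × 𝔼reward (chainInstance (expand bs)) Th ≤ β × 𝔼OPT (chainInstance (expand bs))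
    deterministic Th =
      let _ , every = checks
          t , le , bounds t≢0 reward≤ = bounds-expand bs P every Th
      in cross-multiply α β {{t≢0}} {{offline-scale≢0 3 (expand bs) zeroTable _}}
           (reward≤ 3 ℕₚ.≤-refl) (offline-≤-𝔼OPT (expand bs)) (ℕₚ.≤ᵇ⇒≤ _ _ le)

-- The numerical instance.

-- Odds 15, 0 and 999 stand for the probabilities 1/16, 1 and 1/1000; the last number of each item
-- is its rank in the chain.
blocks : List (ℕ and Item)
blocks = (64 , item 15 4 3) ∷ (64 , item 15 10 2) ∷ (1 , item 0 29 1) ∷ (1 , item 999 29000 1) ∷ []

gap : gap? 2217 1000 blocks (offline 3 (expand blocks) zeroTable) ≡ true
-- Evaluation visits all profiles: 65 counts of open items for each of the two large blocks and 2
-- for each single item.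
gap = ≡.refl

theorem3p7 : ∀ {c ℓ₁ ℓ₂ a b : Level} (𝔽 : OrderedField c ℓ₁ ℓ₂) →
    let open Prophet 𝔽 in
    Σ Instance λ I →
    (0# < 𝔼OPT I) and
    (∀ (ALG : NonAdaptive a b I) → 2217 × 𝔼ALG I ALG ≤ 1000 × 𝔼OPT I)
theorem3p7 𝔽 = chainInstance (expand blocks) , gap⇒instance 2217 1000 blocks (Equivalence.from T-≡ gap)
  where open ChainInstance 𝔽
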